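{- Let $r\ge2$ and let $H$ be an intersecting $r$-partite hypergraph in which every vertex has positive degree, with $\tau(H)=r$ and maximum degree $\Delta$. Then $$(r+1/2)^2\Delta^2+4r^2\ \ge\ (8r^2-2r)\Delta .$$
   Context: A hypergraph $H$ is a set of non-empty subsets (lines) of a finite vertex set $V(H)$. The degree of a vertex is the number of lines containing it. $H$ is $r$-partite if $V(H)$ is partitioned into $r$ sets (sides) such that every line contains exactly one vertex from each side. A cover is a set of vertices meeting every line; $\tau(H)$ is the minimum size of a cover. $H$ is intersecting if every two lines share at least one vertex. -}

module Defs where

open import Data.Nat using (ℕ; _≤_)
open import Data.Fin using (Fin)
open import Data.Fin.Subset using (Subset; _∈_; ∣_∣; Nonempty)
open import Data.Vec using (tabulate; lookup)
open import Data.Product using (Σ; _×_; ∃; ∃-syntax)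
open import Function.Definitions using (Injective)
open import Relation.Binary.PropositionalEquality using (_≡_)

-- A hypergraph on vertex set Fin n with m lines, the lines being given
-- as subsets of Fin n (indexed by Fin m).  Lines must be non-empty and
-- pairwise distinct (the hypergraph is a *set* of lines).
record Hypergraph (n m : ℕ) : Set where
  field
    line     : Fin m → Subset n
    nonempty : ∀ i → Nonempty (line i)
    distinct : Injective _≡_ _≡_ line
open Hypergraph public

degree : ∀ {n m} → Hypergraph n m → Fin n → ℕ
degree H v = ∣ tabulate (λ i → lookup (line H i) v) ∣

IsPartition : ∀ {n m} (r : ℕ) → Hypergraph n m → (Fin n → Fin r) → Set
IsPartition {n} r H side =
  ∀ i (s : Fin r) → Σ (Fin n) λ v →
    (v ∈ line H i × side v ≡ s) ×
    (∀ w → w ∈ line H i → side w ≡ s → w ≡ v)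

RPartite : ∀ {n m} (r : ℕ) → Hypergraph n m → Set
RPartite r H = ∃[ side ] IsPartition r H side

Intersecting : ∀ {n m} → Hypergraph n m → Set
Intersecting {n} H = ∀ i j → ∃[ v ] (v ∈ line H i × v ∈ line H j)

IsCover : ∀ {n m} → Hypergraph n m → Subset n → Set
IsCover {n} H C = ∀ i → ∃[ v ] (v ∈ C × v ∈ line H i)

CoverNumber : ∀ {n m} → Hypergraph n m → ℕ → Set
CoverNumber H t =
  (∃[ C ] (IsCover H C × ∣ C ∣ ≡ t)) × (∀ C → IsCover H C → t ≤ ∣ C ∣)

MaxDegree : ∀ {n m} → Hypergraph n m → ℕ → Set
MaxDegree H Δ = (∃[ v ] degree H v ≡ Δ) × (∀ v → degree H v ≤ Δ)

{-# OPTIONS --safe #-}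

-- A line L is a cover of size r = τ, so no r - 1 vertices cover.  Since L - v is not a cover, every
-- vertex has degree at least 2.  If v ≠ w in L both had degree 2, with further lines M ∋ v and N ∋ w,
-- then L - v - w together with a point of M ∩ N would cover; hence every line has at most one vertex
-- of degree 2 and there are at most m / 2 such vertices.  Summing d² + 3Δ ≤ (Δ + 3) d, valid for
-- 3 ≤ d ≤ Δ and failing by Δ - 2 for d = 2, over the n ≥ r² vertices (each side is a cover), and using
-- m² + r m ≤ Σ d² + m (lines meet pairwise), gives 2 m² + 6 Δ r² ≤ ((2r + 1) Δ + 4r) m.
-- The claim says that this quadratic in m has non-negative discriminant.
module Submission where

open import Defs
open import Data.Nat using (ℕ; zero; suc; _+_; _*_; _^_; _≤_; _<_; _≤?_; z≤n; s≤s; s≤s⁻¹)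
open import Data.Nat.Properties hiding (_≟_; 0≢1+n)
open import Data.Nat.Tactic.RingSolver using (solve-∀)
open import Data.Bool using (Bool; if_then_else_)
open import Data.Fin using (Fin; zero; suc; _≟_)
open import Data.Fin.Properties using (0≢1+n)
open import Data.Fin.Subset
  using (Subset; _∈_; ∣_∣; _∩_; _∪_; _-_; ⁅_⁆; ⊤; inside; outside; Nonempty)
open import Data.Fin.Subset.Properties
  using (p⊆q⇒∣p∣≤∣q∣; ∣⁅x⁆∣≡1; x∈⁅x⁆; ∣⊤∣≡n; x∈p∩q⁺; x∈p∩q⁻; x∈p∪q⁺; x∈p∧x≢y⇒x∈p-y;
         x∈p⇒∣p-x∣<∣p∣; p─q⊆p; nonempty?; Empty-unique; ∣⊥∣≡0; ∩-identityˡ)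
open import Data.Vec using ([]; _∷_; tabulate; lookup)
open import Data.Vec.Properties using (lookup∘tabulate; lookup⇒[]=; []=⇒lookup)
open import Data.Product using (_×_; _,_; ∃-syntax)
open import Data.Sum using (_⊎_; inj₁; inj₂)
open import Function using (_∘_; const)
open import Relation.Nullary using (yes; no; does; contradiction)
open import Relation.Nullary.Decidable using (dec-true)
open import Relation.Unary using (Pred; Decidable)
open import Relation.Binary.PropositionalEquality
open import Algebra.Properties.Semiring.Sum +-*-semiring
  using (sum; ∑-comm; ∑-distrib-+; sum-cong-≗; *-distribˡ-sum; *-distribʳ-sum)

private
  variable
    n m r : ℕ

-- Sums over finite index sets.

sum-mono : {f g : Fin n → ℕ} → (∀ i → f i ≤ g i) → sum f ≤ sum g
sum-mono {zero}  f≤g = z≤n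
sum-mono {suc n} f≤g = +-mono-≤ (f≤g zero) (sum-mono (f≤g ∘ suc))

sum-const : ∀ n (c : ℕ) → sum {n} (const c) ≡ n * c
sum-const zero    c = refl
sum-const (suc n) c = cong (c +_) (sum-const n c)

sum-≤-const : {f : Fin n → ℕ} (c : ℕ) → (∀ i → f i ≤ c) → sum f ≤ n * c
sum-≤-const {n} c f≤c = ≤-trans (sum-mono f≤c) (≤-reflexive (sum-const n c))

sum-≥-const : {f : Fin n → ℕ} (c : ℕ) → (∀ i → c ≤ f i) → n * c ≤ sum f
sum-≥-const {n} {f} c c≤f = ≤-trans (≤-reflexive (sym (sum-const n c))) (sum-mono {g = f} c≤f)

-- The `n - 1` terms other than `f i` contribute at least 1 each; the `+ 1` on the right avoids
-- subtraction.
sum-positive : (f : Fin n → ℕ) → (∀ i → 1 ≤ f i) → ∀ i → f i + n ≤ sum f + 1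
sum-positive {suc n} f 1≤f zero = begin
  f zero + suc n             ≡⟨ eq (f zero) n ⟩
  f zero + n * 1 + 1         ≤⟨ +-monoˡ-≤ 1 (+-monoʳ-≤ (f zero) (sum-≥-const 1 (1≤f ∘ suc))) ⟩
  f zero + sum (f ∘ suc) + 1 ∎
  where
  open ≤-Reasoning
  eq : ∀ a b → a + suc b ≡ a + b * 1 + 1
  eq = solve-∀
sum-positive {suc n} f 1≤f (suc i) = begin
  f (suc i) + suc n            ≡⟨ +-suc (f (suc i)) n ⟩
  1 + (f (suc i) + n)          ≤⟨ +-mono-≤ (1≤f zero) (sum-positive (f ∘ suc) (1≤f ∘ suc) i) ⟩
  f zero + (sum (f ∘ suc) + 1) ≡⟨ +-assoc (f zero) _ 1 ⟨
  f zero + sum (f ∘ suc) + 1   ∎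
  where open ≤-Reasoning

-- Cardinalities and indicator functions of subsets.

𝟙 : Bool → ℕ
𝟙 b = if b then 1 else 0

χ : Subset n → Fin n → ℕ
χ p v = 𝟙 (lookup p v)

∣p∣≡∑χ : (p : Subset n) → ∣ p ∣ ≡ sum (χ p)
∣p∣≡∑χ []            = refl
∣p∣≡∑χ (inside  ∷ p) = cong suc (∣p∣≡∑χ p)
∣p∣≡∑χ (outside ∷ p) = ∣p∣≡∑χ p

∣p∩q∣≡∑χ : (p q : Subset n) → ∣ p ∩ q ∣ ≡ sum (λ v → χ p v * χ q v)
∣p∩q∣≡∑χ []            []            = refl
∣p∩q∣≡∑χ (inside  ∷ p) (inside  ∷ q) = cong suc (∣p∩q∣≡∑χ p q)
∣p∩q∣≡∑χ (inside  ∷ p) (outside ∷ q) = ∣p∩q∣≡∑χ p q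
∣p∩q∣≡∑χ (outside ∷ p) (_       ∷ q) = ∣p∩q∣≡∑χ p q

∣p∪q∣≤∣p∣+∣q∣ : (p q : Subset n) → ∣ p ∪ q ∣ ≤ ∣ p ∣ + ∣ q ∣
∣p∪q∣≤∣p∣+∣q∣ []            []            = z≤n
∣p∪q∣≤∣p∣+∣q∣ (inside  ∷ p) (inside  ∷ q) =
  s≤s (≤-trans (∣p∪q∣≤∣p∣+∣q∣ p q) (+-monoʳ-≤ ∣ p ∣ (n≤1+n ∣ q ∣)))
∣p∪q∣≤∣p∣+∣q∣ (inside  ∷ p) (outside ∷ q) = s≤s (∣p∪q∣≤∣p∣+∣q∣ p q)
∣p∪q∣≤∣p∣+∣q∣ (outside ∷ p) (inside  ∷ q) =
  ≤-trans (s≤s (∣p∪q∣≤∣p∣+∣q∣ p q)) (≤-reflexive (sym (+-suc ∣ p ∣ ∣ q ∣)))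
∣p∪q∣≤∣p∣+∣q∣ (outside ∷ p) (outside ∷ q) = ∣p∪q∣≤∣p∣+∣q∣ p q

Nonempty⇒1≤∣p∣ : {p : Subset n} → Nonempty p → 1 ≤ ∣ p ∣
Nonempty⇒1≤∣p∣ (_ , x∈p) = ≤-<-trans z≤n (x∈p⇒∣p-x∣<∣p∣ x∈p)

subsingleton⇒∣p∣≤1 : (p : Subset n) → (∀ {v w} → v ∈ p → w ∈ p → v ≡ w) → ∣ p ∣ ≤ 1
subsingleton⇒∣p∣≤1 {n} p unique with nonempty? p
... | no  p-empty   = ≤-trans (≤-reflexive (trans (cong ∣_∣ (Empty-unique p-empty)) (∣⊥∣≡0 n))) z≤n
... | yes (v , v∈p) = ≤-trans
  (p⊆q⇒∣p∣≤∣q∣ λ w∈p → subst (_∈ ⁅ v ⁆) (unique v∈p w∈p) (x∈⁅x⁆ v))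
  (≤-reflexive (∣⁅x⁆∣≡1 v))

∣p∣≤1⇒unique : {p : Subset n} {x y : Fin n} → ∣ p ∣ ≤ 1 → x ∈ p → y ∈ p → y ≡ x
∣p∣≤1⇒unique {p = p} {x} {y} ∣p∣≤1 x∈p y∈p with y ≟ x
... | yes y≡x = y≡x
... | no  y≢x = contradiction
  (≤-trans (≤-<-trans (Nonempty⇒1≤∣p∣ (y , x∈p∧x≢y⇒x∈p-y y∈p y≢x)) (x∈p⇒∣p-x∣<∣p∣ x∈p)) ∣p∣≤1)
  1+n≰n

∣p∣≤2⇒pair : {p : Subset n} {x : Fin n} → ∣ p ∣ ≤ 2 → x ∈ p →
  ∃[ y ] (y ∈ p × (∀ z → z ∈ p → z ≡ x ⊎ z ≡ y))
∣p∣≤2⇒pair {p = p} {x} ∣p∣≤2 x∈p with nonempty? (p - x)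
-- If `x` is the only element, the witness `y` repeats it, so singletons need no separate treatment
-- later.
... | no p-x-empty = x , x∈p , only
  where
  only : ∀ z → z ∈ p → z ≡ x ⊎ z ≡ x
  only z z∈p with z ≟ x
  ... | yes z≡x = inj₁ z≡x
  ... | no  z≢x = contradiction (z , x∈p∧x≢y⇒x∈p-y z∈p z≢x) p-x-empty
... | yes (y , y∈p-x) = y , p─q⊆p p ⁅ x ⁆ y∈p-x , only
  where
  only : ∀ z → z ∈ p → z ≡ x ⊎ z ≡ y
  only z z∈p with z ≟ x
  ... | yes z≡x = inj₁ z≡x
  ... | no  z≢x = inj₂ (∣p∣≤1⇒unique (s≤s⁻¹ (≤-trans (x∈p⇒∣p-x∣<∣p∣ x∈p) ∣p∣≤2)) y∈p-x
                                      (x∈p∧x≢y⇒x∈p-y z∈p z≢x))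

-- Decidable subsets and the splitting of a set by sides.

⟦_⟧ : ∀ {ℓ} {P : Pred (Fin n) ℓ} → Decidable P → Subset n
⟦ P? ⟧ = tabulate (does ∘ P?)

∈-⟦⟧⁺ : ∀ {ℓ} {P : Pred (Fin n) ℓ} (P? : Decidable P) {v} → P v → v ∈ ⟦ P? ⟧
∈-⟦⟧⁺ P? {v} Pv = lookup⇒[]= v _ (trans (lookup∘tabulate (does ∘ P?) v) (dec-true (P? v) Pv))

∈-⟦⟧⁻ : ∀ {ℓ} {P : Pred (Fin n) ℓ} (P? : Decidable P) {v} → v ∈ ⟦ P? ⟧ → P v
∈-⟦⟧⁻ P? {v} v∈ with P? v | trans (sym (lookup∘tabulate (does ∘ P?) v)) ([]=⇒lookup v∈)
... | yes Pv | _  = Pv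
... | no  _  | ()

fiber : (Fin n → Fin r) → Fin r → Subset n
fiber side s = ⟦ (λ v → side v ≟ s) ⟧

∑χ-fiber : (side : Fin n → Fin r) (v : Fin n) → sum (λ s → χ (fiber side s) v) ≡ 1
∑χ-fiber side v = begin
  -- The decision `side v ≟ s` is reread as membership of `s` in a set of sides, which is a
  -- singleton.
  sum (λ s → χ (fiber side s) v)        ≡⟨ sum-cong-≗ (λ s → cong 𝟙 (trans
                                             (lookup∘tabulate (λ w → does (side w ≟ s)) v)
                                             (sym (lookup∘tabulate (λ t → does (side v ≟ t)) s)))) ⟩
  sum (χ ⟦ side v ≟_ ⟧)                 ≡⟨ ∣p∣≡∑χ ⟦ side v ≟_ ⟧ ⟨
  ∣ ⟦ side v ≟_ ⟧ ∣                     ≡⟨ ≤-antisym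
    (subsingleton⇒∣p∣≤1 _ λ a b → trans (sym (∈-⟦⟧⁻ (side v ≟_) a)) (∈-⟦⟧⁻ (side v ≟_) b))
    (Nonempty⇒1≤∣p∣ (side v , ∈-⟦⟧⁺ (side v ≟_) refl)) ⟩
  1                                     ∎
  where open ≡-Reasoning

-- Multiply each `χ p v` by the 1 of `∑χ-fiber` and exchange the sums. Applied to a line for
-- `size≤r` and to `⊤` for `r²≤n`.
∣p∣≡∑∣p∩fiber∣ : (side : Fin n → Fin r) (p : Subset n) → ∣ p ∣ ≡ sum (λ s → ∣ p ∩ fiber side s ∣)
∣p∣≡∑∣p∩fiber∣ side p = begin
  ∣ p ∣                                            ≡⟨ ∣p∣≡∑χ p ⟩
  sum (χ p)                                        ≡⟨ sum-cong-≗ (λ v → begin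
    χ p v                                               ≡⟨ *-identityʳ (χ p v) ⟨
    χ p v * 1                                           ≡⟨ cong (χ p v *_) (∑χ-fiber side v) ⟨
    χ p v * sum (λ s → χ (fiber side s) v)              ≡⟨ *-distribˡ-sum (χ p v) (λ s → χ (fiber side s) v) ⟩
    sum (λ s → χ p v * χ (fiber side s) v)              ∎) ⟩
  sum (λ v → sum (λ s → χ p v * χ (fiber side s) v)) ≡⟨ ∑-comm (λ v s → χ p v * χ (fiber side s) v) ⟩
  sum (λ s → sum (λ v → χ p v * χ (fiber side s) v)) ≡⟨ sum-cong-≗ (λ s → ∣p∩q∣≡∑χ p (fiber side s)) ⟨
  sum (λ s → ∣ p ∩ fiber side s ∣)                 ∎
  where open ≡-Reasoning

other : 2 ≤ r → (s : Fin r) → ∃[ t ] t ≢ s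
other (s≤s (s≤s _)) zero    = suc zero , 0≢1+n ∘ sym
other (s≤s (s≤s _)) (suc s) = zero , 0≢1+n

-- Double counting of incidences.

module _ (H : Hypergraph n m) where

  -- The same `tabulate` as in `degree`, so `degree H v` is `∣ star v ∣` by definition and degree
  -- bounds feed the subset lemmas directly.
  star : Fin n → Subset m
  star v = tabulate (λ i → lookup (line H i) v)

  ∈-star⁺ : ∀ {v i} → v ∈ line H i → i ∈ star v
  ∈-star⁺ {v} {i} v∈ = lookup⇒[]= i _ (trans (lookup∘tabulate _ i) ([]=⇒lookup v∈))

  ∈-star⁻ : ∀ {v i} → i ∈ star v → v ∈ line H i
  ∈-star⁻ {v} {i} i∈ = lookup⇒[]= v _ (trans (sym (lookup∘tabulate _ i)) ([]=⇒lookup i∈))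

  ∑-degree : (w : Fin n → ℕ) →
    sum (λ v → degree H v * w v) ≡ sum (λ i → sum (λ v → χ (line H i) v * w v))
  ∑-degree w = trans (sum-cong-≗ step) (∑-comm (λ v i → χ (line H i) v * w v))
    where
    open ≡-Reasoning
    step : ∀ v → degree H v * w v ≡ sum (λ i → χ (line H i) v * w v)
    step v = begin
      degree H v * w v                    ≡⟨ cong (_* w v) (∣p∣≡∑χ (star v)) ⟩
      sum (χ (star v)) * w v              ≡⟨ cong (_* w v) (sum-cong-≗ λ i → cong 𝟙
                                               (lookup∘tabulate (λ j → lookup (line H j) v) i)) ⟩
      sum (λ i → χ (line H i) v) * w v    ≡⟨ *-distribʳ-sum (w v) (λ i → χ (line H i) v) ⟩
      sum (λ i → χ (line H i) v * w v)    ∎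

  ∑-degree-∩ : (p : Subset n) →
    sum (λ v → degree H v * χ p v) ≡ sum (λ i → ∣ line H i ∩ p ∣)
  ∑-degree-∩ p = trans (∑-degree (χ p)) (sum-cong-≗ λ i → sym (∣p∩q∣≡∑χ (line H i) p))

  -- Both sides count triples of a vertex and two lines through it: double count with weight
  -- `degree H`, then again inside each line.
  ∑-degree² : sum (λ v → degree H v * degree H v) ≡ sum (λ i → sum (λ j → ∣ line H j ∩ line H i ∣))
  ∑-degree² = trans (∑-degree (degree H)) (sum-cong-≗ λ i → trans
    (sum-cong-≗ λ v → *-comm (χ (line H i) v) (degree H v))
    (∑-degree-∩ (line H i)))

  ∑-size : sum (degree H) ≡ sum (λ i → ∣ line H i ∣)
  ∑-size = begin
    sum (degree H)                                    ≡⟨ sum-cong-≗ (λ v → *-identityʳ (degree H v)) ⟨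
    sum (λ v → degree H v * 1)                        ≡⟨ ∑-degree (const 1) ⟩
    sum (λ i → sum (λ v → χ (line H i) v * 1))        ≡⟨ sum-cong-≗ (λ i → trans
      (sum-cong-≗ λ v → *-identityʳ (χ (line H i) v)) (sym (∣p∣≡∑χ (line H i)))) ⟩
    sum (λ i → ∣ line H i ∣)                          ∎
    where open ≡-Reasoning

  -- In the matrix `common` of intersection sizes, whose total is the sum of squared degrees, row
  -- `i` has a diagonal entry of at least `size i` and `m - 1` further entries that are positive by
  -- `meet`.
  intersecting⇒m²+∑d≤∑d²+m : Intersecting H →
    m * m + sum (degree H) ≤ sum (λ v → degree H v * degree H v) + m
  intersecting⇒m²+∑d≤∑d²+m meet = begin
    m * m + sum (degree H)                ≡⟨ cong (m * m +_) ∑-size ⟩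
    m * m + sum size                      ≡⟨ cong (_+ sum size) (sum-const m m) ⟨
    sum (const {B = Fin m} m) + sum size  ≡⟨ ∑-distrib-+ (const m) size ⟨
    sum (λ i → m + size i)                ≤⟨ sum-mono row ⟩
    sum (λ i → sum (common i) + 1)        ≡⟨ ∑-distrib-+ (sum ∘ common) (const 1) ⟩
    sum (sum ∘ common) + sum (const {B = Fin m} 1)
                                          ≡⟨ cong₂ _+_ (sym ∑-degree²) (trans (sum-const m 1) (*-identityʳ m)) ⟩
    sum (λ v → degree H v * degree H v) + m ∎
    where
    open ≤-Reasoning
    size : Fin m → ℕ
    size i = ∣ line H i ∣
    common : Fin m → Fin m → ℕ
    common i j = ∣ line H j ∩ line H i ∣
    row : ∀ i → m + size i ≤ sum (common i) + 1
    row i = begin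
      m + size i         ≡⟨ +-comm m (size i) ⟩
      size i + m         ≤⟨ +-monoˡ-≤ m (p⊆q⇒∣p∣≤∣q∣ {p = line H i} λ x∈ → x∈p∩q⁺ (x∈ , x∈)) ⟩
      common i i + m     ≤⟨ sum-positive (common i)
                              (λ j → let u , u∈i , u∈j = meet i j
                                     in Nonempty⇒1≤∣p∣ (u , x∈p∩q⁺ (u∈j , u∈i))) i ⟩
      sum (common i) + 1 ∎

  -- Sizes of lines and sides in the partite setting.

  module _ (side : Fin n → Fin r) (partite : IsPartition r H side) where

    side-unique : ∀ i {v w} → v ∈ line H i → w ∈ line H i → side v ≡ side w → v ≡ w
    side-unique i {v} {w} v∈ w∈ eq with partite i (side w)
    ... | _ , _ , unique = trans (unique v v∈ eq) (sym (unique w w∈ refl))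

    size≤r : ∀ i → ∣ line H i ∣ ≤ r
    size≤r i = begin
      ∣ line H i ∣                               ≡⟨ ∣p∣≡∑∣p∩fiber∣ side (line H i) ⟩
      sum (λ s → ∣ line H i ∩ fiber side s ∣)    ≤⟨ sum-≤-const 1 (λ s → subsingleton⇒∣p∣≤1 _ (single s)) ⟩
      r * 1                                      ≡⟨ *-identityʳ r ⟩
      r                                          ∎
      where
      open ≤-Reasoning
      single : ∀ s {v w} → v ∈ line H i ∩ fiber side s → w ∈ line H i ∩ fiber side s → v ≡ w
      single s v∈ w∈ with x∈p∩q⁻ _ _ v∈ | x∈p∩q⁻ _ _ w∈
      ... | v∈i , v∈s | w∈i , w∈s = side-unique i v∈i w∈i
        (trans (∈-⟦⟧⁻ (λ u → side u ≟ s) v∈s) (sym (∈-⟦⟧⁻ (λ u → side u ≟ s) w∈s)))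

    module _ (r≤cover : ∀ C → IsCover H C → r ≤ ∣ C ∣) where

      r²≤n : r * r ≤ n
      r²≤n = begin
        r * r                                ≤⟨ sum-≥-const r (λ s → r≤cover (fiber side s) (covers s)) ⟩
        sum (λ s → ∣ fiber side s ∣)         ≡⟨ sum-cong-≗ (λ s → cong ∣_∣ (∩-identityˡ (fiber side s))) ⟨
        sum (λ s → ∣ ⊤ ∩ fiber side s ∣)     ≡⟨ ∣p∣≡∑∣p∩fiber∣ side ⊤ ⟨
        ∣ ⊤ {n} ∣                            ≡⟨ ∣⊤∣≡n n ⟩
        n                                    ∎
        where
        open ≤-Reasoning
        covers : ∀ s → IsCover H (fiber side s)
        covers s i with partite i s
        ... | v , (v∈i , side≡) , _ = v , ∈-⟦⟧⁺ (λ u → side u ≟ s) side≡ , v∈i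

      -- Vertices of small degree.

      module _ (meet : Intersecting H) where

        -- If `l` were the only line through `v`, every other line would meet `l` away from `v`, so
        -- `line H l - v` would be a cover with fewer than `r` vertices.
        2≤degree : 2 ≤ r → (∀ v → 0 < degree H v) → ∀ v → 2 ≤ degree H v
        2≤degree 2≤r positive v with degree H v ≤? 1
        ... | no  d≰1 = ≰⇒> d≰1
        ... | yes d≤1 with nonempty? (star v)
        ... | no star-empty = contradiction
          (≤-trans (positive v) (≤-reflexive (trans (cong ∣_∣ (Empty-unique star-empty)) (∣⊥∣≡0 m))))
          1+n≰n
        ... | yes (l , l∈) = contradiction
          (≤-<-trans (r≤cover (line H l - v) covers)
            (<-≤-trans (x∈p⇒∣p-x∣<∣p∣ (∈-star⁻ l∈)) (size≤r l)))
          1+n≰n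
          where
          covers : IsCover H (line H l - v)
          covers i with meet l i
          ... | u , u∈l , u∈i with u ≟ v
          ... | no  u≢v  = u , x∈p∧x≢y⇒x∈p-y u∈l u≢v , u∈i
          -- Here `i` is `l` itself, which keeps a vertex on some side other than that of `v`
          -- because `2 ≤ r`.
          ... | yes refl with ∣p∣≤1⇒unique d≤1 l∈ (∈-star⁺ u∈i) | other 2≤r (side v)
          ... | refl | t , t≢ with partite l t
          ... | x , (x∈l , refl) , _ = x , x∈p∧x≢y⇒x∈p-y x∈l (λ { refl → t≢ refl }) , x∈l

        -- Every line through `v` is `l` or `a`, and every line through `w` is `l` or `b`. Trading
        -- `v` and `w` for one point `u` of `a` and `b` gives the too small cover `C`; that `C`
        -- still meets `l` needs the partition into sides.
        small-unique : ∀ l {v w} → v ∈ line H l → w ∈ line H l →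
          degree H v ≤ 2 → degree H w ≤ 2 → v ≡ w
        small-unique l {v} {w} v∈l w∈l dv≤2 dw≤2 with v ≟ w
        ... | yes v≡w = v≡w
        ... | no  v≢w with ∣p∣≤2⇒pair dv≤2 (∈-star⁺ v∈l) | ∣p∣≤2⇒pair dw≤2 (∈-star⁺ w∈l)
        ... | a , a∈v , only-v | b , b∈w , only-w with meet a b
        ... | u , u∈a , u∈b = contradiction (≤-<-trans (r≤cover C covers) ∣C∣<r) 1+n≰n
          where
          C : Subset n
          C = (line H l - v - w) ∪ ⁅ u ⁆

          rest⊆C : ∀ {x} → x ∈ line H l → x ≢ v → x ≢ w → x ∈ C
          rest⊆C x∈l x≢v x≢w = x∈p∪q⁺ (inj₁ (x∈p∧x≢y⇒x∈p-y (x∈p∧x≢y⇒x∈p-y x∈l x≢v) x≢w))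

          u∈C : u ∈ C
          u∈C = x∈p∪q⁺ (inj₂ (x∈⁅x⁆ u))

          -- The vertex of l on the side of u is in C: if it is v or w, it equals u.
          l-covered : ∃[ x ] (x ∈ C × x ∈ line H l)
          l-covered with partite l (side u)
          ... | z , (z∈l , side≡) , _ with z ≟ v | z ≟ w
          ... | yes refl | _        = z , subst (_∈ C) (side-unique a u∈a (∈-star⁻ a∈v) (sym side≡)) u∈C , z∈l
          ... | no  _    | yes refl = z , subst (_∈ C) (side-unique b u∈b (∈-star⁻ b∈w) (sym side≡)) u∈C , z∈l
          ... | no  z≢v  | no  z≢w  = z , rest⊆C z∈l z≢v z≢w , z∈l

          covers : IsCover H C
          covers i with meet l i
          ... | x , x∈l , x∈i with x ≟ v | x ≟ w
          ... | no  x≢v  | no  x≢w  = x , rest⊆C x∈l x≢v x≢w , x∈i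
          -- A line through `v` is either `l` or `a`, and `a` contains `u`; the case of `w` and `b`
          -- is symmetric.
          ... | yes refl | _ with only-v i (∈-star⁺ x∈i)
          ...   | inj₁ refl = l-covered
          ...   | inj₂ refl = u , u∈C , u∈a
          covers i | x , x∈l , x∈i | no _ | yes refl with only-w i (∈-star⁺ x∈i)
          ...   | inj₁ refl = l-covered
          ...   | inj₂ refl = u , u∈C , u∈b

          ∣C∣<r : ∣ C ∣ < r
          ∣C∣<r = begin-strict
            ∣ C ∣                            ≤⟨ ∣p∪q∣≤∣p∣+∣q∣ (line H l - v - w) ⁅ u ⁆ ⟩
            ∣ line H l - v - w ∣ + ∣ ⁅ u ⁆ ∣ ≡⟨ cong (∣ line H l - v - w ∣ +_) (∣⁅x⁆∣≡1 u) ⟩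
            ∣ line H l - v - w ∣ + 1         ≡⟨ +-comm _ 1 ⟩
            suc ∣ line H l - v - w ∣         ≤⟨ x∈p⇒∣p-x∣<∣p∣ (x∈p∧x≢y⇒x∈p-y w∈l (v≢w ∘ sym)) ⟩
            ∣ line H l - v ∣                 <⟨ x∈p⇒∣p-x∣<∣p∣ v∈l ⟩
            ∣ line H l ∣                     ≤⟨ size≤r l ⟩
            r                                ∎
            where open ≤-Reasoning

        -- Once `2≤degree` applies, these are the vertices of degree exactly 2.
        small : Subset n
        small = ⟦ (λ v → degree H v ≤? 2) ⟧

        -- The sum counts incidences of lines with small vertices, at most one per line by
        -- `small-unique`. Weighting by degree avoids halving `m`.
        ∑-small≤m : sum (λ v → degree H v * χ small v) ≤ m
        ∑-small≤m = begin
          sum (λ v → degree H v * χ small v) ≡⟨ ∑-degree-∩ small ⟩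
          sum (λ i → ∣ line H i ∩ small ∣)   ≤⟨ sum-≤-const 1 (λ i → subsingleton⇒∣p∣≤1 _ (single i)) ⟩
          m * 1                              ≡⟨ *-identityʳ m ⟩
          m                                  ∎
          where
          open ≤-Reasoning
          single : ∀ i {v w} → v ∈ line H i ∩ small → w ∈ line H i ∩ small → v ≡ w
          single i v∈ w∈ with x∈p∩q⁻ _ _ v∈ | x∈p∩q⁻ _ _ w∈
          ... | v∈i , v-small | w∈i , w-small = small-unique i v∈i w∈i
            (∈-⟦⟧⁻ (λ u → degree H u ≤? 2) v-small) (∈-⟦⟧⁻ (λ u → degree H u ≤? 2) w-small)

-- Arithmetic of the quadratic inequality.

-- With Δ = 2 + k, twice (d - 3) (d - Δ) ≤ [d = 2] k, using 2 = d in the term for d = 2.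
degree-bound : ∀ k d → 2 ≤ d → d ≤ 2 + k →
  2 * (d * d) + 6 * (2 + k) ≤ 2 * (5 + k) * d + k * (d * 𝟙 (does (d ≤? 2)))
degree-bound k 0 () _
degree-bound k 1 (s≤s ()) _
degree-bound k 2 _ _ = ≤-reflexive (eq k)
  where
  eq : ∀ k → 2 * (2 * 2) + 6 * (2 + k) ≡ 2 * (5 + k) * 2 + k * (2 * 1)
  eq = solve-∀
degree-bound k (suc (suc (suc a))) _ (s≤s (s≤s a<k)) with m≤n⇒∃[o]m+o≡n a<k
... | b , refl = m+n≤o⇒m≤o _ (≤-reflexive (eq a b))
  where
  eq : ∀ a b → 2 * ((3 + a) * (3 + a)) + 6 * (2 + (1 + a + b)) + 2 * (a * b)
             ≡ 2 * (5 + (1 + a + b)) * (3 + a) + (1 + a + b) * ((3 + a) * 0)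
  eq = solve-∀

2xy≤x²+y² : ∀ x y → 2 * (x * y) ≤ x * x + y * y
2xy≤x²+y² x y with ≤-total x y
... | inj₁ x≤y with m≤n⇒∃[o]m+o≡n x≤y
...   | k , refl = m+n≤o⇒m≤o _ (≤-reflexive (eq x k))
  where
  eq : ∀ x k → 2 * (x * (x + k)) + k * k ≡ x * x + (x + k) * (x + k)
  eq = solve-∀
2xy≤x²+y² x y | inj₂ y≤x with m≤n⇒∃[o]m+o≡n y≤x
...   | k , refl = m+n≤o⇒m≤o _ (≤-reflexive (eq y k))
  where
  eq : ∀ y k → 2 * ((y + k) * y) + k * k ≡ (y + k) * (y + k) + y * y
  eq = solve-∀

-- Completing the square: over the integers, the hypothesis times 8 reads `8 * c` at most `b * b`
-- minus the square of `4 * m - b`. Adding `16 * (m * m)` to both sides keeps this in `ℕ`.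
discriminant : ∀ m b c → 2 * (m * m) + c ≤ b * m → 8 * c ≤ b * b
discriminant m b c quadratic = +-cancelʳ-≤ (16 * (m * m)) _ _ (begin
  8 * c + 16 * (m * m)        ≡⟨ eq₁ m c ⟩
  8 * (2 * (m * m) + c)       ≤⟨ *-monoʳ-≤ 8 quadratic ⟩
  8 * (b * m)                 ≡⟨ eq₂ b m ⟩
  2 * (b * (4 * m))           ≤⟨ 2xy≤x²+y² b (4 * m) ⟩
  b * b + 4 * m * (4 * m)     ≡⟨ eq₃ b m ⟩
  b * b + 16 * (m * m)        ∎)
  where
  open ≤-Reasoning
  eq₁ : ∀ m c → 8 * c + 16 * (m * m) ≡ 8 * (2 * (m * m) + c)
  eq₁ = solve-∀
  eq₂ : ∀ b m → 8 * (b * m) ≡ 2 * (b * (4 * m))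
  eq₂ = solve-∀
  eq₃ : ∀ b m → b * b + 4 * m * (4 * m) ≡ b * b + 16 * (m * m)
  eq₃ = solve-∀

-- Here `S` and `Q` stand for the sums of degrees and of squared degrees, `E` for the degree sum
-- over `small`, and `2 + k` for `Δ`. Cancelling `2 * S` before bounding what remains by `S ≤ m * r`
-- means that only an upper bound on line sizes enters.
quadratic-in-m : ∀ k {r n m S Q E} → m * m + S ≤ Q + m →
  2 * Q + n * (6 * (2 + k)) ≤ 2 * (5 + k) * S + k * E → E ≤ m → S ≤ m * r → r * r ≤ n →
  2 * (m * m) + 6 * (2 + k) * (r * r) ≤ ((2 * r + 1) * (2 + k) + 4 * r) * m
quadratic-in-m k {r} {n} {m} {S} {Q} {E} pairs local E≤m S≤mr r²≤n = +-cancelʳ-≤ (2 * S) _ _ (begin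
  2 * (m * m) + 6 * (2 + k) * (r * r) + 2 * S       ≡⟨ eq₁ k r m S ⟩
  2 * (m * m + S) + r * r * (6 * (2 + k))           ≤⟨ +-mono-≤ (*-monoʳ-≤ 2 pairs) (*-monoˡ-≤ (6 * (2 + k)) r²≤n) ⟩
  2 * (Q + m) + n * (6 * (2 + k))                   ≡⟨ eq₂ Q m (n * (6 * (2 + k))) ⟩
  2 * Q + n * (6 * (2 + k)) + 2 * m                 ≤⟨ +-monoˡ-≤ (2 * m) local ⟩
  2 * (5 + k) * S + k * E + 2 * m                   ≤⟨ +-monoˡ-≤ (2 * m) (+-monoʳ-≤ (2 * (5 + k) * S) (*-monoʳ-≤ k E≤m)) ⟩
  2 * (5 + k) * S + k * m + 2 * m                   ≡⟨ eq₃ k S m ⟩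
  2 * (4 + k) * S + (2 + k) * m + 2 * S             ≤⟨ +-monoˡ-≤ (2 * S) (+-monoˡ-≤ ((2 + k) * m) (*-monoʳ-≤ (2 * (4 + k)) S≤mr)) ⟩
  2 * (4 + k) * (m * r) + (2 + k) * m + 2 * S       ≡⟨ eq₄ k r m S ⟩
  ((2 * r + 1) * (2 + k) + 4 * r) * m + 2 * S       ∎)
  where
  open ≤-Reasoning
  eq₁ : ∀ k r m S → 2 * (m * m) + 6 * (2 + k) * (r * r) + 2 * S
                  ≡ 2 * (m * m + S) + r * r * (6 * (2 + k))
  eq₁ = solve-∀
  eq₂ : ∀ Q m c → 2 * (Q + m) + c ≡ 2 * Q + c + 2 * m
  eq₂ = solve-∀
  eq₃ : ∀ k S m → 2 * (5 + k) * S + k * m + 2 * m ≡ 2 * (4 + k) * S + (2 + k) * m + 2 * S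
  eq₃ = solve-∀
  eq₄ : ∀ k r m S → 2 * (4 + k) * (m * r) + (2 + k) * m + 2 * S
                  ≡ ((2 * r + 1) * (2 + k) + 4 * r) * m + 2 * S
  eq₄ = solve-∀

-- The claimed inequality is multiplied by 4 to clear the fraction, and `8 * r * Δ` is moved to the
-- right to avoid subtraction.
theorem2p3 : (r n m : ℕ) → 2 ≤ r → (H : Hypergraph n m) →
    Intersecting H → RPartite r H → (∀ v → 0 < degree H v) →
    CoverNumber H r → (Δ : ℕ) → MaxDegree H Δ →
    32 * r ^ 2 * Δ ≤ (2 * r + 1) ^ 2 * Δ ^ 2 + 16 * r ^ 2 + 8 * r * Δ
theorem2p3 r n m 2≤r H meet (side , partite) positive (_ , r≤cover) Δ ((v₀ , d≡Δ) , d≤Δ)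
  -- `Δ` is the degree of `v₀`, hence at least 2, and can be written as `2 + k`.
  with m≤n⇒∃[o]m+o≡n (≤-trans (2≤degree H side partite r≤cover meet 2≤r positive v₀) (≤-reflexive d≡Δ))
-- The discriminant gives `48 * r ^ 2 * Δ` on the left, while the cross term of the square is
-- `16 * (r * r) * Δ + 8 * r * Δ`; cancelling its first part leaves the coefficient 32.
... | k , refl = +-cancelʳ-≤ (16 * (r * r) * Δ) _ _ (begin
  32 * r ^ 2 * Δ + 16 * (r * r) * Δ
    ≡⟨ eq₁ r Δ ⟩
  8 * (6 * Δ * (r * r))
    ≤⟨ discriminant m ((2 * r + 1) * Δ + 4 * r) (6 * Δ * (r * r)) (quadratic-in-m k
         (intersecting⇒m²+∑d≤∑d²+m H meet) local
         (∑-small≤m H side partite r≤cover meet) ∑d≤mr (r²≤n H side partite r≤cover)) ⟩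
  ((2 * r + 1) * Δ + 4 * r) * ((2 * r + 1) * Δ + 4 * r)
    ≡⟨ eq₂ r Δ ⟩
  (2 * r + 1) ^ 2 * Δ ^ 2 + 16 * r ^ 2 + 8 * r * Δ + 16 * (r * r) * Δ ∎)
  where
  open ≤-Reasoning

  d e : Fin n → ℕ
  d = degree H
  e v = d v * χ (small H side partite r≤cover meet) v

  ∑d≤mr : sum d ≤ m * r
  ∑d≤mr = ≤-trans (≤-reflexive (∑-size H)) (sum-≤-const r (size≤r H side partite))

  local-at : ∀ v → 2 * (d v * d v) + 6 * (2 + k) ≤ 2 * (5 + k) * d v + k * e v
  local-at v = ≤-trans
    (degree-bound k (d v) (2≤degree H side partite r≤cover meet 2≤r positive v) (d≤Δ v))
    (≤-reflexive (cong (λ b → 2 * (5 + k) * d v + k * (d v * 𝟙 b))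
      (sym (lookup∘tabulate (λ u → does (d u ≤? 2)) v))))

  local : 2 * sum (λ v → d v * d v) + n * (6 * (2 + k)) ≤ 2 * (5 + k) * sum d + k * sum e
  local = begin
    2 * sum (λ v → d v * d v) + n * (6 * (2 + k))
      ≡⟨ cong₂ _+_ (*-distribˡ-sum 2 (λ v → d v * d v)) (sym (sum-const n (6 * (2 + k)))) ⟩
    sum (λ v → 2 * (d v * d v)) + sum (const {B = Fin n} (6 * (2 + k)))
      ≡⟨ ∑-distrib-+ (λ v → 2 * (d v * d v)) (const (6 * (2 + k))) ⟨
    sum (λ v → 2 * (d v * d v) + 6 * (2 + k))
      ≤⟨ sum-mono local-at ⟩
    sum (λ v → 2 * (5 + k) * d v + k * e v)
      ≡⟨ ∑-distrib-+ (λ v → 2 * (5 + k) * d v) (λ v → k * e v) ⟩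
    sum (λ v → 2 * (5 + k) * d v) + sum (λ v → k * e v)
      ≡⟨ cong₂ _+_ (*-distribˡ-sum (2 * (5 + k)) d) (*-distribˡ-sum k e) ⟨
    2 * (5 + k) * sum d + k * sum e ∎

  -- x * (x * 1) is the unfolding of x ^ 2.
  eq₁ : ∀ r Δ → 32 * (r * (r * 1)) * Δ + 16 * (r * r) * Δ ≡ 8 * (6 * Δ * (r * r))
  eq₁ = solve-∀

  eq₂ : ∀ r Δ → ((2 * r + 1) * Δ + 4 * r) * ((2 * r + 1) * Δ + 4 * r)
              ≡ (2 * r + 1) * ((2 * r + 1) * 1) * (Δ * (Δ * 1)) + 16 * (r * (r * 1))
                + 8 * r * Δ + 16 * (r * r) * Δ
  eq₂ = solve-∀
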